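{- Let $\alpha_1,\alpha_2,\alpha_3\in\mathbb{C}$. For arrays $\mathbf{x}=(x_s)_{s\in\mathbb{Z}}$, $\mathbf{y}=(y_s)_{s\in\mathbb{Z}}$ and $v\in\mathbb{Z}$ write $z_i=x_{v+i}$, $w_i=y_{v+i}$, and $D=\alpha_3^2z_1^6+2\alpha_2\alpha_3z_0z_1^4z_2+(\alpha_2^2-4\alpha_1)z_0^2z_1^2z_2^2-4\alpha_3z_0^3z_2^3$. Consider the conditions (for all $v\in\mathbb{Z}$): (E) $z_0^2z_3^2+\alpha_1z_1^2z_2^2+\alpha_2z_0z_1z_2z_3+\alpha_3(z_0z_2^3+z_1^3z_3)=0$; (Coh) $z_0^2z_3=z_{ -1}z_2^2$; (R1) $z_3=\dfrac{ -\alpha_3z_1^3-\alpha_2z_0z_1z_2+w_1}{2z_0^2}$; (R2) $w_2=\dfrac{\alpha_3^2z_1^6+\alpha_2\alpha_3z_0z_1^4z_2+2\alpha_3z_0^3z_2^3+w_1^2+(-2\alpha_3z_1^3-\alpha_2z_0z_1z_2)w_1}{2z_0^3}$; (S) $w_1^2=D$. (a) For any $\mathbf{x}\in(\mathbb{C}^*)^{\mathbb{Z}}$ satisfying (E) and (Coh) there exists $\mathbf{y}\in\mathbb{C}^{\mathbb{Z}}$ such that $\mathbf{x},\mathbf{y}$ satisfy (R1), (R2), (S). (b) Conversely, if $\mathbf{x}\in(\mathbb{C}^*)^{\mathbb{Z}}$ and $\mathbf{y}\in\mathbb{C}^{\mathbb{Z}}$ satisfy (R1), (R2), (S), then $\mathbf{x}$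 satisfies (E) and (Coh). -}

module Defs where

open import Algebra.Bundles using (CommutativeRing)
open import Data.Integer.Base as ℤ using (ℤ; -1ℤ; 0ℤ; 1ℤ)
open import Data.Nat.Base as ℕ using (ℕ; zero; suc)
open import Data.Product.Base using (∃; _×_; _,_; proj₁; proj₂)
open import Level using (0ℓ)

module ComplexNumbers where

  open import Data.Empty using (⊥-elim)
  import Data.Nat.Properties as ℕ
  open import Data.Rational.Base using (ℚ; 0ℚ; 1ℚ; ½; _+_; _*_; _-_; -_; ∣_∣; _<_; _≤_; 1/_; positive; nonNegative; ≢-nonZero)
  open import Data.Rational.Properties as ℚ using (_≟_)
  open import Data.Rational.Solver using (module +-*-Solver)
  open import Data.Sum.Base using (inj₁; inj₂)
  open import Relation.Binary.PropositionalEquality using (_≡_; refl; sym; trans; cong; cong₂; subst; subst₂)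
  open import Relation.Nullary using (¬_; yes; no)
  open +-*-Solver using (solve; con; _:=_; _:+_; _:*_; _:-_; :-_)

  0<1 : 0ℚ < 1ℚ
  0<1 = ℚ.positive⁻¹ 1ℚ

  0<½ : 0ℚ < ½
  0<½ = ℚ.positive⁻¹ ½

  *-pos : ∀ {p q} → 0ℚ < p → 0ℚ < q → 0ℚ < p * q
  *-pos {p} {q} 0<p 0<q =
    subst (_< p * q) (ℚ.*-zeroʳ p) (ℚ.*-monoʳ-<-pos p {{positive 0<p}} 0<q)

  *-mono-≤ : ∀ {p q r s} → 0ℚ ≤ r → 0ℚ ≤ q → p ≤ q → r ≤ s → p * r ≤ q * s
  *-mono-≤ {p} {q} {r} {s} 0≤r 0≤q p≤q r≤s =
    ℚ.≤-trans (ℚ.*-monoʳ-≤-nonNeg r {{nonNegative 0≤r}} p≤q)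
              (ℚ.*-monoˡ-≤-nonNeg q {{nonNegative 0≤q}} r≤s)

  halves : ∀ p → p * ½ + p * ½ ≡ p
  halves p = trans (sym (ℚ.*-distribˡ-+ p ½ ½)) (ℚ.*-identityʳ p)

  ∣∣-split : ∀ {p ε} q r → p ≡ q + r → ∣ q ∣ < ε * ½ → ∣ r ∣ < ε * ½ → ∣ p ∣ < ε
  ∣∣-split {p} {ε} q r refl q< r< =
    ℚ.≤-<-trans (ℚ.∣p+q∣≤∣p∣+∣q∣ q r)
      (subst (∣ q ∣ + ∣ r ∣ <_) (halves ε) (ℚ.+-mono-< q< r<))

  p≤∣p∣ : ∀ p → p ≤ ∣ p ∣
  p≤∣p∣ p with ℚ.≤-total 0ℚ p
  ... | inj₁ 0≤p = ℚ.≤-reflexive (sym (ℚ.0≤p⇒∣p∣≡p 0≤p))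
  ... | inj₂ p≤0 = ℚ.≤-trans p≤0 (ℚ.0≤∣p∣ p)

  0≤p² : ∀ p → 0ℚ ≤ p * p
  0≤p² p = subst (0ℚ ≤_) eq
      (subst (_≤ ∣ p ∣ * ∣ p ∣) (ℚ.*-zeroʳ ∣ p ∣)
        (ℚ.*-monoˡ-≤-nonNeg ∣ p ∣ {{nonNegative (ℚ.0≤∣p∣ p)}} (ℚ.0≤∣p∣ p)))
    where
    eq : ∣ p ∣ * ∣ p ∣ ≡ p * p
    eq with ℚ.∣p∣≡p∨∣p∣≡-p p
    ... | inj₁ e = cong₂ _*_ e e
    ... | inj₂ e = trans (cong₂ _*_ e e) (solve 1 (λ a → (:- a) :* (:- a) := a :* a) refl p)

  recip : ℚ → ℚ
  recip p with p ≟ 0ℚ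
  ... | yes _  = 0ℚ
  ... | no p≢0 = 1/_ p {{≢-nonZero p≢0}}

  recip-inverseˡ : ∀ {p} → 0ℚ < p → recip p * p ≡ 1ℚ
  recip-inverseˡ {p} 0<p with p ≟ 0ℚ
  ... | yes p≡0 = ⊥-elim (ℚ.<-irrefl (sym p≡0) 0<p)
  ... | no p≢0  = ℚ.*-inverseˡ p {{≢-nonZero p≢0}}

  recip-pos : ∀ {p} → 0ℚ < p → 0ℚ < recip p
  recip-pos {p} 0<p = ℚ.*-cancelʳ-<-nonNeg p {{nonNegative (ℚ.<⇒≤ 0<p)}}
    (subst₂ _<_ (sym (ℚ.*-zeroˡ p)) (sym (recip-inverseˡ 0<p)) 0<1)

  recip-anti : ∀ {p q} → 0ℚ < p → p ≤ q → recip q ≤ recip p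
  recip-anti {p} {q} 0<p p≤q =
    subst₂ _≤_ lhs rhs
      (ℚ.*-monoʳ-≤-nonNeg (recip p * recip q) {{nonNegative (ℚ.<⇒≤ 0<rs)}} p≤q)
    where
    0<q = ℚ.<-≤-trans 0<p p≤q
    r = recip p
    s = recip q
    0<rs = *-pos (recip-pos 0<p) (recip-pos 0<q)
    lhs : p * (r * s) ≡ s
    lhs = trans (solve 3 (λ p r s → p :* (r :* s) := (r :* p) :* s) refl p r s)
         (trans (cong (_* s) (recip-inverseˡ 0<p)) (ℚ.*-identityˡ s))
    rhs : q * (r * s) ≡ r
    rhs = trans (solve 3 (λ q r s → q :* (r :* s) := (s :* q) :* r) refl q r s)
         (trans (cong (_* r) (recip-inverseˡ 0<q)) (ℚ.*-identityˡ r))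

  -- If ∣ q ∣ ≤ B and ∣ d ∣ < shrink ε B then ∣ q * d ∣ < ε.
  shrink : ℚ → ℚ → ℚ
  shrink ε B = ε * recip B

  shrink-pos : ∀ {ε B} → 0ℚ < ε → 0ℚ < B → 0ℚ < shrink ε B
  shrink-pos 0<ε 0<B = *-pos 0<ε (recip-pos 0<B)

  shrink-< : ∀ {ε B} q d → 0ℚ < B → ∣ q ∣ ≤ B → ∣ d ∣ < shrink ε B → ∣ q * d ∣ < ε
  shrink-< {ε} {B} q d 0<B q≤B d<δ = subst₂ _<_ (sym (ℚ.∣p*q∣≡∣p∣*∣q∣ q d)) eq
    (ℚ.≤-<-trans
      (ℚ.*-monoʳ-≤-nonNeg ∣ d ∣ {{nonNegative (ℚ.0≤∣p∣ d)}} q≤B)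
      (ℚ.*-monoʳ-<-pos B {{positive 0<B}} d<δ))
    where
    eq : B * (ε * recip B) ≡ ε
    eq = trans (solve 3 (λ b e r → b :* (e :* r) := e :* (r :* b)) refl B ε (recip B))
        (trans (cong (ε *_) (recip-inverseˡ 0<B)) (ℚ.*-identityʳ ε))

  -- Real numbers: Cauchy sequences of rationals, with equality "the
  -- difference tends to 0".

  IsNull : (ℕ → ℚ) → Set
  IsNull f = ∀ ε → 0ℚ < ε → ∃ λ N → ∀ n → N ℕ.≤ n → ∣ f n ∣ < ε

  IsCauchy : (ℕ → ℚ) → Set
  IsCauchy f = ∀ ε → 0ℚ < ε →
    ∃ λ N → ∀ m n → N ℕ.≤ m → N ℕ.≤ n → ∣ f m - f n ∣ < ε

  record ℝ : Set where
    constructor mkℝ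
    field
      seq    : ℕ → ℚ
      cauchy : IsCauchy seq
  open ℝ public

  infix 4 _≈ᴿ_
  record _≈ᴿ_ (x y : ℝ) : Set where
    constructor mk≈
    field
      null : IsNull (λ n → seq x n - seq y n)
  open _≈ᴿ_ public

  -- Strict positivity: bounded away from 0 from some index on.
  record Posᴿ (x : ℝ) : Set where
    constructor mkPos
    field
      bound   : ℚ
      0<bound : 0ℚ < bound
      from    : ℕ
      bound≤  : ∀ n → from ℕ.≤ n → bound ≤ seq x n
  open Posᴿ public

  ⊔ˡ : ∀ {M N n} → M ℕ.⊔ N ℕ.≤ n → M ℕ.≤ n
  ⊔ˡ {M} {N} h = ℕ.≤-trans (ℕ.m≤m⊔n M N) h

  ⊔ʳ : ∀ {M N n} → M ℕ.⊔ N ℕ.≤ n → N ℕ.≤ n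
  ⊔ʳ {M} {N} h = ℕ.≤-trans (ℕ.m≤n⊔m M N) h

  abstract

    eventuallyBounded : ∀ {f} → IsCauchy f →
      ∃ λ B → 0ℚ < B × ∃ λ N → ∀ n → N ℕ.≤ n → ∣ f n ∣ ≤ B
    eventuallyBounded {f} c = let N , h = c 1ℚ 0<1 in
        1ℚ + ∣ f N ∣
      , ℚ.<-≤-trans 0<1 (subst (_≤ 1ℚ + ∣ f N ∣) (ℚ.+-identityʳ 1ℚ)
          (ℚ.+-monoʳ-≤ 1ℚ (ℚ.0≤∣p∣ (f N))))
      , N , λ n N≤n → subst (λ t → ∣ t ∣ ≤ 1ℚ + ∣ f N ∣)
          (solve 2 (λ a b → (a :- b) :+ b := a) refl (f n) (f N))
          (ℚ.≤-trans (ℚ.∣p+q∣≤∣p∣+∣q∣ (f n - f N) (f N))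
            (ℚ.+-monoˡ-≤ ∣ f N ∣ (ℚ.<⇒≤ (h n N N≤n ℕ.≤-refl))))

    cauchy-const : ∀ p → IsCauchy (λ _ → p)
    cauchy-const p ε 0<ε = 0 , λ _ _ _ _ →
      subst (λ t → ∣ t ∣ < ε) (sym (ℚ.+-inverseʳ p)) 0<ε

    cauchy-+ : ∀ {f g} → IsCauchy f → IsCauchy g → IsCauchy (λ n → f n + g n)
    cauchy-+ {f} {g} cf cg ε 0<ε =
      let M , hf = cf (ε * ½) (*-pos 0<ε 0<½)
          N , hg = cg (ε * ½) (*-pos 0<ε 0<½)
      in M ℕ.⊔ N , λ m n p q →
      ∣∣-split (f m - f n) (g m - g n)
        (solve 4 (λ a b c d → (a :+ b) :- (c :+ d) := (a :- c) :+ (b :- d)) refl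
          (f m) (g m) (f n) (g n))
        (hf m n (⊔ˡ p) (⊔ˡ q)) (hg m n (⊔ʳ {M} p) (⊔ʳ {M} q))

    cauchy-neg : ∀ {f} → IsCauchy f → IsCauchy (λ n → - f n)
    cauchy-neg {f} cf ε 0<ε = let N , h = cf ε 0<ε in N , λ m n p q → subst (_< ε)
      (trans (sym (ℚ.∣-p∣≡∣p∣ (f m - f n)))
        (cong ∣_∣ (solve 2 (λ a b → :- (a :- b) := (:- a) :- (:- b)) refl (f m) (f n))))
      (h m n p q)

    cauchy-* : ∀ {f g} → IsCauchy f → IsCauchy g → IsCauchy (λ n → f n * g n)
    cauchy-* {f} {g} cf cg ε 0<ε =
      let A , 0<A , K , hA = eventuallyBounded {f} cf
          B , 0<B , L , hB = eventuallyBounded {g} cg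
          M , hf = cf (shrink (ε * ½) B) (shrink-pos (*-pos 0<ε 0<½) 0<B)
          N , hg = cg (shrink (ε * ½) A) (shrink-pos (*-pos 0<ε 0<½) 0<A)
      in (K ℕ.⊔ L) ℕ.⊔ (M ℕ.⊔ N) , λ m n p q →
      ∣∣-split (f m * (g m - g n)) (g n * (f m - f n))
        (solve 4 (λ a b c d → (a :* b) :- (c :* d) := (a :* (b :- d)) :+ (d :* (a :- c))) refl
          (f m) (g m) (f n) (g n))
        (shrink-< (f m) (g m - g n) 0<A (hA m (⊔ˡ (⊔ˡ p)))
          (hg m n (⊔ʳ {M} (⊔ʳ {K ℕ.⊔ L} p)) (⊔ʳ {M} (⊔ʳ {K ℕ.⊔ L} q))))
        (shrink-< (g n) (f m - f n) 0<B (hB n (⊔ʳ {K} (⊔ˡ q)))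
          (hf m n (⊔ˡ (⊔ʳ {K ℕ.⊔ L} p)) (⊔ˡ (⊔ʳ {K ℕ.⊔ L} q))))

    cauchy-recip : ∀ {x} → Posᴿ x → IsCauchy (λ n → recip (seq x n))
    cauchy-recip {mkℝ f cf} (mkPos b 0<b K hb) ε 0<ε =
      let N , h = cf (shrink ε (recip b * recip b))
                    (shrink-pos 0<ε (*-pos (recip-pos 0<b) (recip-pos 0<b)))
      in K ℕ.⊔ N , λ m n p q →
      let r   = recip (f m)
          s   = recip (f n)
          0<m = ℚ.<-≤-trans 0<b (hb m (⊔ˡ p))
          0<n = ℚ.<-≤-trans 0<b (hb n (⊔ˡ q))
          0≤r = ℚ.<⇒≤ (recip-pos 0<m)
          0≤s = ℚ.<⇒≤ (recip-pos 0<n)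
          0≤rs = ℚ.<⇒≤ (*-pos (recip-pos 0<m) (recip-pos 0<n))
          eq : (r * s) * (f n - f m) ≡ r - s
          eq = trans
            (solve 4 (λ r s a b → (r :* s) :* (b :- a) := r :* (s :* b) :- s :* (r :* a)) refl
              r s (f m) (f n))
            (cong₂ _-_
              (trans (cong (r *_) (recip-inverseˡ 0<n)) (ℚ.*-identityʳ r))
              (trans (cong (s *_) (recip-inverseˡ 0<m)) (ℚ.*-identityʳ s)))
      in subst (λ t → ∣ t ∣ < ε) eq
           (shrink-< (r * s) (f n - f m) (*-pos (recip-pos 0<b) (recip-pos 0<b))
             (subst (_≤ recip b * recip b) (sym (ℚ.0≤p⇒∣p∣≡p 0≤rs))
               (*-mono-≤ 0≤s (ℚ.<⇒≤ (recip-pos 0<b))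
                 (recip-anti 0<b (hb m (⊔ˡ p))) (recip-anti 0<b (hb n (⊔ˡ q)))))
             (h n m (⊔ʳ {K} q) (⊔ʳ {K} p)))

  fromℚ : ℚ → ℝ
  fromℚ p = mkℝ (λ _ → p) (cauchy-const p)

  infix  8 -ᴿ_
  infixl 7 _*ᴿ_
  infixl 6 _+ᴿ_ _-ᴿ_

  _+ᴿ_ _*ᴿ_ : ℝ → ℝ → ℝ
  x +ᴿ y = mkℝ (λ n → seq x n + seq y n) (cauchy-+ {seq x} {seq y} (cauchy x) (cauchy y))
  x *ᴿ y = mkℝ (λ n → seq x n * seq y n) (cauchy-* {seq x} {seq y} (cauchy x) (cauchy y))

  -ᴿ_ : ℝ → ℝ
  -ᴿ x = mkℝ (λ n → - seq x n) (cauchy-neg {seq x} (cauchy x))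

  _-ᴿ_ : ℝ → ℝ → ℝ
  x -ᴿ y = x +ᴿ (-ᴿ y)

  -- The terms with seq x n = 0 get the junk value 0; Posᴿ x makes them
  -- finitely many.
  recipᴿ : (x : ℝ) → Posᴿ x → ℝ
  recipᴿ x pos = mkℝ (λ n → recip (seq x n)) (cauchy-recip {x} pos)

  ≈ᴿ-eventually : ∀ {x y} N → (∀ n → N ℕ.≤ n → seq x n ≡ seq y n) → x ≈ᴿ y
  ≈ᴿ-eventually {x} {y} N h = mk≈ λ ε 0<ε → N , λ n N≤n →
    subst (λ t → ∣ t ∣ < ε)
      (sym (trans (cong (_- seq y n) (h n N≤n)) (ℚ.+-inverseʳ (seq y n)))) 0<ε

  ≈ᴿ-pointwise : ∀ {x y} → (∀ n → seq x n ≡ seq y n) → x ≈ᴿ y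
  ≈ᴿ-pointwise h = ≈ᴿ-eventually 0 λ n _ → h n

  ≈ᴿ-refl : ∀ {x} → x ≈ᴿ x
  ≈ᴿ-refl = ≈ᴿ-pointwise λ _ → refl

  ≈ᴿ-sym : ∀ {x y} → x ≈ᴿ y → y ≈ᴿ x
  ≈ᴿ-sym {x} {y} (mk≈ h) = mk≈ λ ε 0<ε → let N , k = h ε 0<ε in N , λ n N≤n →
    subst (_< ε)
      (trans (sym (ℚ.∣-p∣≡∣p∣ (seq x n - seq y n)))
        (cong ∣_∣ (solve 2 (λ a b → :- (a :- b) := b :- a) refl (seq x n) (seq y n))))
      (k n N≤n)

  ≈ᴿ-trans : ∀ {x y z} → x ≈ᴿ y → y ≈ᴿ z → x ≈ᴿ z
  ≈ᴿ-trans {x} {y} {z} (mk≈ h) (mk≈ k) = mk≈ λ ε 0<ε →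
    let M , p = h (ε * ½) (*-pos 0<ε 0<½)
        N , q = k (ε * ½) (*-pos 0<ε 0<½)
    in M ℕ.⊔ N , λ n le →
       ∣∣-split (seq x n - seq y n) (seq y n - seq z n)
         (solve 3 (λ a b c → a :- c := (a :- b) :+ (b :- c)) refl (seq x n) (seq y n) (seq z n))
         (p n (⊔ˡ le)) (q n (⊔ʳ {M} le))

  +ᴿ-cong : ∀ {x x′ y y′} → x ≈ᴿ x′ → y ≈ᴿ y′ → x +ᴿ y ≈ᴿ x′ +ᴿ y′
  +ᴿ-cong {x} {x′} {y} {y′} (mk≈ h) (mk≈ k) = mk≈ λ ε 0<ε →
    let M , p = h (ε * ½) (*-pos 0<ε 0<½)
        N , q = k (ε * ½) (*-pos 0<ε 0<½)
    in M ℕ.⊔ N , λ n le →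
       ∣∣-split (seq x n - seq x′ n) (seq y n - seq y′ n)
         (solve 4 (λ a b c d → (a :+ b) :- (c :+ d) := (a :- c) :+ (b :- d)) refl
           (seq x n) (seq y n) (seq x′ n) (seq y′ n))
         (p n (⊔ˡ le)) (q n (⊔ʳ {M} le))

  -ᴿ-cong : ∀ {x y} → x ≈ᴿ y → -ᴿ x ≈ᴿ -ᴿ y
  -ᴿ-cong {x} {y} (mk≈ h) = mk≈ λ ε 0<ε → let N , k = h ε 0<ε in N , λ n N≤n →
    subst (_< ε)
      (trans (sym (ℚ.∣-p∣≡∣p∣ (seq x n - seq y n)))
        (cong ∣_∣ (solve 2 (λ a b → :- (a :- b) := (:- a) :- (:- b)) refl (seq x n) (seq y n))))
      (k n N≤n)

  *ᴿ-cong : ∀ {x x′ y y′} → x ≈ᴿ x′ → y ≈ᴿ y′ → x *ᴿ y ≈ᴿ x′ *ᴿ y′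
  *ᴿ-cong {x} {x′} {y} {y′} (mk≈ h) (mk≈ k) = mk≈ λ ε 0<ε →
    let A , 0<A , K , hA = eventuallyBounded {seq x} (cauchy x)
        B , 0<B , L , hB = eventuallyBounded {seq y′} (cauchy y′)
        M , p = h (shrink (ε * ½) B) (shrink-pos (*-pos 0<ε 0<½) 0<B)
        N , q = k (shrink (ε * ½) A) (shrink-pos (*-pos 0<ε 0<½) 0<A)
    in (K ℕ.⊔ L) ℕ.⊔ (M ℕ.⊔ N) , λ n le →
       ∣∣-split (seq x n * (seq y n - seq y′ n)) (seq y′ n * (seq x n - seq x′ n))
         (solve 4 (λ a b c d → (a :* b) :- (c :* d) := (a :* (b :- d)) :+ (d :* (a :- c))) refl
           (seq x n) (seq y n) (seq x′ n) (seq y′ n))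
         (shrink-< (seq x n) (seq y n - seq y′ n) 0<A (hA n (⊔ˡ (⊔ˡ le))) (q n (⊔ʳ {M} (⊔ʳ {K ℕ.⊔ L} le))))
         (shrink-< (seq y′ n) (seq x n - seq x′ n) 0<B (hB n (⊔ʳ {K} (⊔ˡ le))) (p n (⊔ˡ (⊔ʳ {K ℕ.⊔ L} le))))

  recipᴿ-inverseˡ : ∀ x (pos : Posᴿ x) → recipᴿ x pos *ᴿ x ≈ᴿ fromℚ 1ℚ
  recipᴿ-inverseˡ x (mkPos b 0<b N h) = ≈ᴿ-eventually N λ n N≤n →
    recip-inverseˡ (ℚ.<-≤-trans 0<b (h n N≤n))

  Posᴿ-* : ∀ {x y} → Posᴿ x → Posᴿ y → Posᴿ (x *ᴿ y)
  Posᴿ-* (mkPos a 0<a M h) (mkPos b 0<b N k) = mkPos (a * b) (*-pos 0<a 0<b) (M ℕ.⊔ N) λ n le →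
    *-mono-≤ (ℚ.<⇒≤ 0<b) (ℚ.≤-trans (ℚ.<⇒≤ 0<a) (h n (⊔ˡ le))) (h n (⊔ˡ le)) (k n (⊔ʳ {M} le))

  record ℂ : Set where
    constructor _+i_
    field
      re im : ℝ
  open ℂ public

  infix 4 _≈ᶜ_
  record _≈ᶜ_ (z w : ℂ) : Set where
    constructor _,_
    field
      re≈ : re z ≈ᴿ re w
      im≈ : im z ≈ᴿ im w
  open _≈ᶜ_ public

  0ᶜ 1ᶜ : ℂ
  0ᶜ = fromℚ 0ℚ +i fromℚ 0ℚ
  1ᶜ = fromℚ 1ℚ +i fromℚ 0ℚ

  infix  8 -ᶜ_
  infixl 7 _*ᶜ_
  infixl 6 _+ᶜ_

  _+ᶜ_ _*ᶜ_ : ℂ → ℂ → ℂ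
  (a +i b) +ᶜ (c +i d) = (a +ᴿ c) +i (b +ᴿ d)
  (a +i b) *ᶜ (c +i d) = (a *ᴿ c -ᴿ b *ᴿ d) +i (a *ᴿ d +ᴿ b *ᴿ c)

  -ᶜ_ : ℂ → ℂ
  -ᶜ (a +i b) = (-ᴿ a) +i (-ᴿ b)

  ℂ-*-assoc-re : ∀ a b c d e f → (a * c + - (b * d)) * e + - ((a * d + b * c) * f)
    ≡ a * (c * e + - (d * f)) + - (b * (c * f + d * e))
  ℂ-*-assoc-re = solve 6 (λ a b c d e f → (a :* c :+ :- (b :* d)) :* e :+ :- ((a :* d :+ b :* c) :* f) :=
    a :* (c :* e :+ :- (d :* f)) :+ :- (b :* (c :* f :+ d :* e))) refl

  ℂ-*-assoc-im : ∀ a b c d e f → (a * c + - (b * d)) * f + (a * d + b * c) * e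
    ≡ a * (c * f + d * e) + b * (c * e + - (d * f))
  ℂ-*-assoc-im = solve 6 (λ a b c d e f → (a :* c :+ :- (b :* d)) :* f :+ (a :* d :+ b :* c) :* e :=
    a :* (c :* f :+ d :* e) :+ b :* (c :* e :+ :- (d :* f))) refl

  ℂ-*-identityˡ-re : ∀ a b → 1ℚ * a + - (0ℚ * b) ≡ a
  ℂ-*-identityˡ-re = solve 2 (λ a b → con 1ℚ :* a :+ :- (con 0ℚ :* b) := a) refl

  ℂ-*-identityˡ-im : ∀ a b → 1ℚ * b + 0ℚ * a ≡ b
  ℂ-*-identityˡ-im = solve 2 (λ a b → con 1ℚ :* b :+ con 0ℚ :* a := b) refl

  ℂ-*-identityʳ-re : ∀ a b → a * 1ℚ + - (b * 0ℚ) ≡ a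
  ℂ-*-identityʳ-re = solve 2 (λ a b → a :* con 1ℚ :+ :- (b :* con 0ℚ) := a) refl

  ℂ-*-identityʳ-im : ∀ a b → a * 0ℚ + b * 1ℚ ≡ b
  ℂ-*-identityʳ-im = solve 2 (λ a b → a :* con 0ℚ :+ b :* con 1ℚ := b) refl

  ℂ-distribˡ-re : ∀ a b c d e f → a * (c + e) + - (b * (d + f))
    ≡ (a * c + - (b * d)) + (a * e + - (b * f))
  ℂ-distribˡ-re = solve 6 (λ a b c d e f → a :* (c :+ e) :+ :- (b :* (d :+ f)) :=
    (a :* c :+ :- (b :* d)) :+ (a :* e :+ :- (b :* f))) refl

  ℂ-distribˡ-im : ∀ a b c d e f → a * (d + f) + b * (c + e)
    ≡ (a * d + b * c) + (a * f + b * e)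
  ℂ-distribˡ-im = solve 6 (λ a b c d e f → a :* (d :+ f) :+ b :* (c :+ e) :=
    (a :* d :+ b :* c) :+ (a :* f :+ b :* e)) refl

  ℂ-distribʳ-re : ∀ a b c d e f → (c + e) * a + - ((d + f) * b)
    ≡ (c * a + - (d * b)) + (e * a + - (f * b))
  ℂ-distribʳ-re = solve 6 (λ a b c d e f → (c :+ e) :* a :+ :- ((d :+ f) :* b) :=
    (c :* a :+ :- (d :* b)) :+ (e :* a :+ :- (f :* b))) refl

  ℂ-distribʳ-im : ∀ a b c d e f → (c + e) * b + (d + f) * a
    ≡ (c * b + d * a) + (e * b + f * a)
  ℂ-distribʳ-im = solve 6 (λ a b c d e f → (c :+ e) :* b :+ (d :+ f) :* a :=
    (c :* b :+ d :* a) :+ (e :* b :+ f :* a)) refl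

  ℂ-*-comm-re : ∀ a b c d → a * c + - (b * d)
    ≡ c * a + - (d * b)
  ℂ-*-comm-re = solve 4 (λ a b c d → a :* c :+ :- (b :* d) :=
    c :* a :+ :- (d :* b)) refl

  ℂ-*-comm-im : ∀ a b c d → a * d + b * c
    ≡ c * b + d * a
  ℂ-*-comm-im = solve 4 (λ a b c d → a :* d :+ b :* c :=
    c :* b :+ d :* a) refl

  ℂ-recip-re : ∀ a b r → (a * r) * a + - ((- (b * r)) * b)
    ≡ r * (a * a + b * b)
  ℂ-recip-re = solve 3 (λ a b r → (a :* r) :* a :+ :- ((:- (b :* r)) :* b) :=
    r :* (a :* a :+ b :* b)) refl

  ℂ-recip-im : ∀ a b r → (a * r) * b + (- (b * r)) * a ≡ 0ℚ
  ℂ-recip-im = solve 3 (λ a b r → (a :* r) :* b :+ (:- (b :* r)) :* a := con 0ℚ) refl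

  ℂ-norm-* : ∀ a b c d → (a * a + b * b) * (c * c + d * d)
    ≡ (a * c + - (b * d)) * (a * c + - (b * d)) + (a * d + b * c) * (a * d + b * c)
  ℂ-norm-* = solve 4 (λ a b c d → (a :* a :+ b :* b) :* (c :* c :+ d :* d) :=
    (a :* c :+ :- (b :* d)) :* (a :* c :+ :- (b :* d)) :+ (a :* d :+ b :* c) :* (a :* d :+ b :* c)) refl

  ℂ-commutativeRing : CommutativeRing 0ℓ 0ℓ
  ℂ-commutativeRing = record
    { Carrier = ℂ ; _≈_ = _≈ᶜ_ ; _+_ = _+ᶜ_ ; _*_ = _*ᶜ_ ; -_ = -ᶜ_ ; 0# = 0ᶜ ; 1# = 1ᶜ
    ; isCommutativeRing = record
      { isRing = record
        { +-isAbelianGroup = record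
          { isGroup = record
            { isMonoid = record
              { isSemigroup = record
                { isMagma = record
                  { isEquivalence = record
                    { refl  = ≈ᴿ-refl , ≈ᴿ-refl
                    ; sym   = λ (p , q) → ≈ᴿ-sym p , ≈ᴿ-sym q
                    ; trans = λ (p , q) (r , s) → ≈ᴿ-trans p r , ≈ᴿ-trans q s
                    }
                  ; ∙-cong = λ (p , q) (r , s) → +ᴿ-cong p r , +ᴿ-cong q s
                  }
                ; assoc = λ (a +i b) (c +i d) (e +i f) →
                    ≈ᴿ-pointwise (λ n → ℚ.+-assoc (seq a n) (seq c n) (seq e n)) ,
                    ≈ᴿ-pointwise (λ n → ℚ.+-assoc (seq b n) (seq d n) (seq f n))
                }
              ; identity =
                  (λ (a +i b) → ≈ᴿ-pointwise (λ n → ℚ.+-identityˡ (seq a n)) ,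
                                ≈ᴿ-pointwise (λ n → ℚ.+-identityˡ (seq b n))) ,
                  (λ (a +i b) → ≈ᴿ-pointwise (λ n → ℚ.+-identityʳ (seq a n)) ,
                                ≈ᴿ-pointwise (λ n → ℚ.+-identityʳ (seq b n)))
              }
            ; inverse =
                (λ (a +i b) → ≈ᴿ-pointwise (λ n → ℚ.+-inverseˡ (seq a n)) ,
                              ≈ᴿ-pointwise (λ n → ℚ.+-inverseˡ (seq b n))) ,
                (λ (a +i b) → ≈ᴿ-pointwise (λ n → ℚ.+-inverseʳ (seq a n)) ,
                              ≈ᴿ-pointwise (λ n → ℚ.+-inverseʳ (seq b n)))
            ; ⁻¹-cong = λ (p , q) → -ᴿ-cong p , -ᴿ-cong q
            }
          ; comm = λ (a +i b) (c +i d) →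
              ≈ᴿ-pointwise (λ n → ℚ.+-comm (seq a n) (seq c n)) ,
              ≈ᴿ-pointwise (λ n → ℚ.+-comm (seq b n) (seq d n))
          }
        ; *-cong = λ (p , q) (r , s) →
            +ᴿ-cong (*ᴿ-cong p r) (-ᴿ-cong (*ᴿ-cong q s)) ,
            +ᴿ-cong (*ᴿ-cong p s) (*ᴿ-cong q r)
        ; *-assoc = λ (a +i b) (c +i d) (e +i f) →
            ≈ᴿ-pointwise (λ n → ℂ-*-assoc-re (seq a n) (seq b n) (seq c n) (seq d n) (seq e n) (seq f n)) ,
            ≈ᴿ-pointwise (λ n → ℂ-*-assoc-im (seq a n) (seq b n) (seq c n) (seq d n) (seq e n) (seq f n))
        ; *-identity =
            (λ (a +i b) →
              ≈ᴿ-pointwise (λ n → ℂ-*-identityˡ-re (seq a n) (seq b n)) ,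
              ≈ᴿ-pointwise (λ n → ℂ-*-identityˡ-im (seq a n) (seq b n))) ,
            (λ (a +i b) →
              ≈ᴿ-pointwise (λ n → ℂ-*-identityʳ-re (seq a n) (seq b n)) ,
              ≈ᴿ-pointwise (λ n → ℂ-*-identityʳ-im (seq a n) (seq b n)))
        ; distrib =
            (λ (a +i b) (c +i d) (e +i f) →
              ≈ᴿ-pointwise (λ n → ℂ-distribˡ-re (seq a n) (seq b n) (seq c n) (seq d n) (seq e n) (seq f n)) ,
              ≈ᴿ-pointwise (λ n → ℂ-distribˡ-im (seq a n) (seq b n) (seq c n) (seq d n) (seq e n) (seq f n))) ,
            (λ (a +i b) (c +i d) (e +i f) →
              ≈ᴿ-pointwise (λ n → ℂ-distribʳ-re (seq a n) (seq b n) (seq c n) (seq d n) (seq e n) (seq f n)) ,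
              ≈ᴿ-pointwise (λ n → ℂ-distribʳ-im (seq a n) (seq b n) (seq c n) (seq d n) (seq e n) (seq f n)))
        }
      ; *-comm = λ (a +i b) (c +i d) →
          ≈ᴿ-pointwise (λ n → ℂ-*-comm-re (seq a n) (seq b n) (seq c n) (seq d n)) ,
          ≈ᴿ-pointwise (λ n → ℂ-*-comm-im (seq a n) (seq b n) (seq c n) (seq d n))
      }
    }

  normSq : ℂ → ℝ
  normSq (a +i b) = a *ᴿ a +ᴿ b *ᴿ b

  -- Nonzero in the constructive sense, ∣z∣² > 0.  It is what division
  -- needs, and classically it is the same as ¬ (z ≈ᶜ 0ᶜ): see
  -- nonzero⇒≉0 and ¬nonzero⇒≈0.
  Nonzero : ℂ → Set
  Nonzero z = Posᴿ (normSq z)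

  recipᶜ : (z : ℂ) → Nonzero z → ℂ
  recipᶜ z@(a +i b) nz = (a *ᴿ r) +i (-ᴿ (b *ᴿ r))
    where r = recipᴿ (normSq z) nz

  recipᶜ-inverseˡ : ∀ z (nz : Nonzero z) → recipᶜ z nz *ᶜ z ≈ᶜ 1ᶜ
  recipᶜ-inverseˡ z@(a +i b) nz =
    ≈ᴿ-trans
      (≈ᴿ-pointwise λ n → ℂ-recip-re (seq a n) (seq b n) (seq r n))
      (recipᴿ-inverseˡ (normSq z) nz) ,
    ≈ᴿ-pointwise (λ n → ℂ-recip-im (seq a n) (seq b n) (seq r n))
    where r = recipᴿ (normSq z) nz

  Posᴿ-resp : ∀ {x y} → (∀ n → seq x n ≡ seq y n) → Posᴿ x → Posᴿ y
  Posᴿ-resp h (mkPos b 0<b N k) = mkPos b 0<b N λ n le → subst (b ≤_) (h n) (k n le)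

  Nonzero-* : ∀ {z w} → Nonzero z → Nonzero w → Nonzero (z *ᶜ w)
  Nonzero-* {a +i b} {c +i d} p q = Posᴿ-resp
    (λ n → ℂ-norm-* (seq a n) (seq b n) (seq c n) (seq d n))
    (Posᴿ-* {normSq (a +i b)} {normSq (c +i d)} p q)

  Pos⇒≉0 : ∀ {x} → Posᴿ x → ¬ (x ≈ᴿ fromℚ 0ℚ)
  Pos⇒≉0 {x} (mkPos b 0<b N h) (mk≈ k) = ℚ.<-irrefl refl (ℚ.≤-<-trans (h n (⊔ˡ le)) (ℚ.≤-<-trans (p≤∣p∣ (seq x n))
      (subst (λ t → ∣ t ∣ < b) (solve 1 (λ a → a :- con 0ℚ := a) refl (seq x n)) (l n (⊔ʳ {N} le)))))
    where
    M = proj₁ (k b 0<b)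
    l = proj₂ (k b 0<b)
    n = N ℕ.⊔ M
    le : N ℕ.⊔ M ℕ.≤ n
    le = ℕ.≤-refl

  nonzero⇒≉0 : ∀ {z} → Nonzero z → ¬ (z ≈ᶜ 0ᶜ)
  nonzero⇒≉0 {z} nz (p , q) = Pos⇒≉0 nz (≈ᴿ-trans
    (+ᴿ-cong (*ᴿ-cong p p) (*ᴿ-cong q q)) (≈ᴿ-pointwise λ _ → refl))

  ¬Pos-square⇒≈0 : ∀ x → ¬ Posᴿ (x *ᴿ x) → x ≈ᴿ fromℚ 0ℚ
  ¬Pos-square⇒≈0 x ¬pos = mk≈ λ ε 0<ε →
    let f = seq x
        δ = ε * ½
        η = δ * ½
        0<δ = *-pos 0<ε 0<½
        0<η = *-pos 0<δ 0<½
        N , h = cauchy x η 0<η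
        far : ¬ (δ ≤ ∣ f N ∣)
        far δ≤ = ¬pos (mkPos (η * η) (*-pos 0<η 0<η) N λ n N≤n →
          let η≤ : η ≤ ∣ f n ∣
              η≤ = ℚ.≮⇒≥ λ fn<η → ℚ.<-irrefl refl (ℚ.≤-<-trans δ≤
                (∣∣-split (f N - f n) (f n)
                  (solve 2 (λ a b → a := (a :- b) :+ b) refl (f N) (f n))
                  (h N n ℕ.≤-refl N≤n) fn<η))
          in subst (η * η ≤_)
               (trans (sym (ℚ.∣p*q∣≡∣p∣*∣q∣ (f n) (f n))) (ℚ.0≤p⇒∣p∣≡p (0≤p² (f n))))
               (*-mono-≤ (ℚ.<⇒≤ 0<η) (ℚ.0≤∣p∣ (f n)) η≤ η≤))
        η<δ : η < δ
        η<δ = subst₂ _<_ (ℚ.+-identityˡ η) (halves δ) (ℚ.+-monoˡ-< η 0<η)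
    in N , λ n N≤n → ∣∣-split (f n - f N) (f N)
         (solve 2 (λ a b → a :- con 0ℚ := (a :- b) :+ b) refl (f n) (f N))
         (ℚ.<-trans (h n N N≤n ℕ.≤-refl) η<δ) (ℚ.≰⇒> far)

  ¬nonzero⇒≈0 : ∀ z → ¬ Nonzero z → z ≈ᶜ 0ᶜ
  ¬nonzero⇒≈0 (a +i b) ¬nz =
    ¬Pos-square⇒≈0 a (λ (mkPos β 0<β N h) → ¬nz (mkPos β 0<β N λ n le →
      subst (_≤ _) (ℚ.+-identityʳ β) (ℚ.+-mono-≤ (h n le) (0≤p² (seq b n))))) ,
    ¬Pos-square⇒≈0 b (λ (mkPos β 0<β N h) → ¬nz (mkPos β 0<β N λ n le →
      subst (_≤ _) (ℚ.+-identityˡ β) (ℚ.+-mono-≤ (0≤p² (seq a n)) (h n le))))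

  record ℂ* : Set where
    constructor _,_
    field
      val     : ℂ
      nonzero : Nonzero val
  open ℂ* public

  infixl 7 _*ˣ_ _÷_

  _*ˣ_ : ℂ* → ℂ* → ℂ*
  (z , p) *ˣ (w , q) = (z *ᶜ w) , Nonzero-* {z} {w} p q

  1ˣ 2ˣ : ℂ*
  1ˣ = 1ᶜ , mkPos 1ℚ 0<1 0 λ _ _ → ℚ.≤-refl
  2ˣ = (1ᶜ +ᶜ 1ᶜ) , mkPos _ 0<4 0 λ _ _ → ℚ.≤-refl
    where
    0<4 : 0ℚ < seq (normSq (1ᶜ +ᶜ 1ᶜ)) 0
    0<4 = ℚ.positive⁻¹ _

  infixr 8 _^ˣ_
  _^ˣ_ : ℂ* → ℕ → ℂ*
  u ^ˣ zero  = 1ˣ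
  u ^ˣ suc n = u *ˣ u ^ˣ n

  _÷_ : ℂ → ℂ* → ℂ
  z ÷ (w , nz) = z *ᶜ recipᶜ w nz

open ComplexNumbers public

module Conditions (α₁ α₂ α₃ : ℂ) (x : ℤ → ℂ*) (v : ℤ) where

  open CommutativeRing ℂ-commutativeRing using (_≈_; _+_; _*_; _-_; -_; 0#; 1#; semiring)
  open import Algebra.Properties.Semiring.Exp semiring using (_^_)

  2# 4# : ℂ
  2# = 1# + 1#
  4# = 2# + 2#

  z : ℤ → ℂ
  z i = val (x (v ℤ.+ i))

  z₋₁ z₀ z₁ z₂ z₃ : ℂ
  z₋₁ = z -1ℤ
  z₀  = z 0ℤ
  z₁  = z 1ℤ
  z₂  = z (ℤ.+ 2)
  z₃  = z (ℤ.+ 3)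

  D : ℂ
  D = α₃ ^ 2 * z₁ ^ 6
    + 2# * α₂ * α₃ * z₀ * z₁ ^ 4 * z₂
    + (α₂ ^ 2 - 4# * α₁) * z₀ ^ 2 * z₁ ^ 2 * z₂ ^ 2
    - 4# * α₃ * z₀ ^ 3 * z₂ ^ 3

  E : Set
  E = z₀ ^ 2 * z₃ ^ 2
    + α₁ * z₁ ^ 2 * z₂ ^ 2
    + α₂ * z₀ * z₁ * z₂ * z₃
    + α₃ * (z₀ * z₂ ^ 3 + z₁ ^ 3 * z₃) ≈ 0#

  Coh : Set
  Coh = z₀ ^ 2 * z₃ ≈ z₋₁ * z₂ ^ 2

  module _ (y : ℤ → ℂ) where

    w₁ w₂ : ℂ
    w₁ = y (v ℤ.+ 1ℤ)
    w₂ = y (v ℤ.+ (ℤ.+ 2))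

    z₀ˣ : ℂ*
    z₀ˣ = x (v ℤ.+ 0ℤ)

    R1 : Set
    R1 = z₃ ≈ (- (α₃ * z₁ ^ 3) - α₂ * z₀ * z₁ * z₂ + w₁) ÷ (2ˣ *ˣ z₀ˣ ^ˣ 2)

    R2 : Set
    R2 = w₂ ≈ ( α₃ ^ 2 * z₁ ^ 6
              + α₂ * α₃ * z₀ * z₁ ^ 4 * z₂
              + 2# * α₃ * z₀ ^ 3 * z₂ ^ 3
              + w₁ ^ 2
              + (- (2# * α₃ * z₁ ^ 3) - α₂ * z₀ * z₁ * z₂) * w₁
              ) ÷ (2ˣ *ˣ z₀ˣ ^ˣ 3)

    S : Set
    S = w₁ ^ 2 ≈ D

{-# OPTIONS --safe #-}

-- (R1) says exactly that w₁ = 2 z₀² z₃ + α₃ z₁³ + α₂ z₀ z₁ z₂, so y is determined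
-- by x.  For this w₁ one has the polynomial identity w₁² = D + 4 z₀² e, where e is
-- the left side of (E); hence (S) is equivalent to (E).  The numerator of (R2)
-- becomes 2 z₀³ (2 z₀ z₃² + α₃ z₂³ + α₂ z₁ z₂ z₃), while (R1) at v + 1 gives
-- w₂ = 2 z₁² z₄ + α₃ z₂³ + α₂ z₁ z₂ z₃; hence (R2) at v is equivalent to
-- z₁² z₄ = z₀ z₃², which is (Coh) at v + 1.
module Submission where

open import Defs
open import Algebra.Bundles using (CommutativeRing)
import Algebra.Properties.Ring as RingProperties
import Algebra.Properties.Semiring.Exp as Exp
import Algebra.Solver.Ring.NaturalCoefficients.Default as SemiringSolver
open import Data.Integer.Base as ℤ using (ℤ; -1ℤ; 0ℤ; 1ℤ)
import Data.Integer.Properties as ℤ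
open import Data.Product.Base using (_×_; ∃; _,_)
import Relation.Binary.Reasoning.Setoid as SetoidReasoning
open Conditions using (E; Coh; R1; R2; S)

-- Cancellation of an invertible factor in a commutative ring.

module Units {c ℓ} (R : CommutativeRing c ℓ) where

  open CommutativeRing R
  open SetoidReasoning setoid

  *-cancelˡ-unit : ∀ {d r a b} → r * d ≈ 1# → d * a ≈ d * b → a ≈ b
  *-cancelˡ-unit {d} {r} {a} {b} rd≈1 da≈db = begin
    a           ≈⟨ invert a ⟨
    r * (d * a) ≈⟨ *-congˡ da≈db ⟩
    r * (d * b) ≈⟨ invert b ⟩
    b           ∎
    where
    invert : ∀ t → r * (d * t) ≈ t
    invert t = trans (sym (*-assoc r d t)) (trans (*-congʳ rd≈1) (*-identityˡ t))

-- Polynomial identities over an arbitrary commutative ring.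

module Polynomials {c ℓ} (R : CommutativeRing c ℓ)
  (α₁ α₂ α₃ : CommutativeRing.Carrier R) where

  open CommutativeRing R
  open Exp semiring using (_^_; ^-congˡ)
  open SemiringSolver commutativeSemiring using (solve; _:=_; _:+_; _:*_; _:^_; con)
  open RingProperties ring using (+-cancelˡ; +-cancelʳ)
  open Units R
  open SetoidReasoning setoid

  2# 4# : Carrier
  2# = 1# + 1#
  4# = 2# + 2#

  -- The coefficient of z₃ in `quadratic`, regarded as a polynomial in z₃ with leading coefficient
  -- z₀².
  tail : Carrier → Carrier → Carrier → Carrier
  tail z₀ z₁ z₂ = α₃ * z₁ ^ 3 + α₂ * z₀ * z₁ * z₂

  -- The derivative of `quadratic` in z₃. The bracket isolates the product that (Coh) rewrites.
  root : Carrier → Carrier → Carrier → Carrier → Carrier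
  root z₀ z₁ z₂ z₃ = 2# * (z₀ ^ 2 * z₃) + tail z₀ z₁ z₂

  -- The discriminant b² - 4ac of `quadratic` in z₃, with a = z₀² and b = `tail`.
  discriminant : Carrier → Carrier → Carrier → Carrier
  discriminant z₀ z₁ z₂ =
      α₃ ^ 2 * z₁ ^ 6
    + 2# * α₂ * α₃ * z₀ * z₁ ^ 4 * z₂
    + (α₂ ^ 2 - 4# * α₁) * z₀ ^ 2 * z₁ ^ 2 * z₂ ^ 2
    - 4# * α₃ * z₀ ^ 3 * z₂ ^ 3

  quadratic : Carrier → Carrier → Carrier → Carrier → Carrier
  quadratic z₀ z₁ z₂ z₃ =
      z₀ ^ 2 * z₃ ^ 2
    + α₁ * z₁ ^ 2 * z₂ ^ 2
    + α₂ * z₀ * z₁ * z₂ * z₃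
    + α₃ * (z₀ * z₂ ^ 3 + z₁ ^ 3 * z₃)

  numerator₁ : Carrier → Carrier → Carrier → Carrier → Carrier
  numerator₁ z₀ z₁ z₂ w = - (α₃ * z₁ ^ 3) - α₂ * z₀ * z₁ * z₂ + w

  numerator₂ : Carrier → Carrier → Carrier → Carrier → Carrier
  numerator₂ z₀ z₁ z₂ w =
      α₃ ^ 2 * z₁ ^ 6
    + α₂ * α₃ * z₀ * z₁ ^ 4 * z₂
    + 2# * α₃ * z₀ ^ 3 * z₂ ^ 3
    + w ^ 2
    + (- (2# * α₃ * z₁ ^ 3) - α₂ * z₀ * z₁ * z₂) * w

  -- The solver knows no negation, so each negated term -t enters the identities
  -- below as a fresh variable, balanced by a summand t - t.

  numerator₁+tail : ∀ z₀ z₁ z₂ w → numerator₁ z₀ z₁ z₂ w + tail z₀ z₁ z₂ ≈ w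
  numerator₁+tail z₀ z₁ z₂ w = begin
    (- s - t + w) + (s + t)
      ≈⟨ solve 5 (λ s s′ t t′ w → (s′ :+ t′ :+ w) :+ (s :+ t) :=
                                  (s :+ s′) :+ ((t :+ t′) :+ w)) refl s (- s) t (- t) w ⟩
    (s - s) + ((t - t) + w)
      ≈⟨ +-cong (-‿inverseʳ s) (+-congʳ (-‿inverseʳ t)) ⟩
    0# + (0# + w)
      ≈⟨ trans (+-identityˡ _) (+-identityˡ w) ⟩
    w ∎
    where
    s = α₃ * z₁ ^ 3
    t = α₂ * z₀ * z₁ * z₂

  -- Completing the square: (2a z₃ + b)² = (b² - 4ac) + 4a (a z₃² + b z₃ + c).
  root² : ∀ z₀ z₁ z₂ z₃ → root z₀ z₁ z₂ z₃ ^ 2 ≈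
    discriminant z₀ z₁ z₂ + 2# * 2# * z₀ ^ 2 * quadratic z₀ z₁ z₂ z₃
  root² z₀ z₁ z₂ z₃ = begin
    root z₀ z₁ z₂ z₃ ^ 2
      ≈⟨ +-identityʳ _ ⟨
    root z₀ z₁ z₂ z₃ ^ 2 + 0#
      ≈⟨ +-congˡ (trans (+-cong (trans (*-congʳ (-‿inverseʳ s)) (zeroˡ m)) (-‿inverseʳ t))
                        (+-identityˡ 0#)) ⟨
    root z₀ z₁ z₂ z₃ ^ 2 + ((s - s) * m + (t - t))
      ≈⟨ solve 9 (λ a b c p q r u s′ t′ →
           let two = con 2
               four = two :+ two
           in (two :* (p :^ 2 :* u) :+ (c :* q :^ 3 :+ b :* p :* q :* r)) :^ 2
              :+ ((four :* a :+ s′) :* (p :^ 2 :* q :^ 2 :* r :^ 2)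
              :+ (four :* c :* p :^ 3 :* r :^ 3 :+ t′))
           := (c :^ 2 :* q :^ 6 :+ two :* b :* c :* p :* q :^ 4 :* r
              :+ (b :^ 2 :+ s′) :* p :^ 2 :* q :^ 2 :* r :^ 2 :+ t′)
              :+ two :* two :* p :^ 2 :*
                 (p :^ 2 :* u :^ 2 :+ a :* q :^ 2 :* r :^ 2 :+ b :* p :* q :* r :* u
                 :+ c :* (p :* r :^ 3 :+ q :^ 3 :* u)))
           refl α₁ α₂ α₃ z₀ z₁ z₂ z₃ (- s) (- t) ⟩
    discriminant z₀ z₁ z₂ + 2# * 2# * z₀ ^ 2 * quadratic z₀ z₁ z₂ z₃ ∎
    where
    s = 4# * α₁
    m = z₀ ^ 2 * z₁ ^ 2 * z₂ ^ 2
    t = 4# * α₃ * z₀ ^ 3 * z₂ ^ 3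

  -- With A = α₃ z₁³ and B = α₂ z₀ z₁ z₂ the numerator is (w - A)(w - A - B) + 2 α₃ z₀³ z₂³, and at
  -- the root w - A - B = 2 z₀² z₃.
  numerator₂-root : ∀ z₀ z₁ z₂ z₃ → numerator₂ z₀ z₁ z₂ (root z₀ z₁ z₂ z₃) ≈
    2# * z₀ ^ 3 * (2# * (z₀ * z₃ ^ 2) + tail z₁ z₂ z₃)
  numerator₂-root z₀ z₁ z₂ z₃ = sym (begin
    2# * z₀ ^ 3 * (2# * (z₀ * z₃ ^ 2) + tail z₁ z₂ z₃)
      ≈⟨ +-identityʳ _ ⟨
    2# * z₀ ^ 3 * (2# * (z₀ * z₃ ^ 2) + tail z₁ z₂ z₃) + 0#
      ≈⟨ +-congˡ (trans (*-congʳ (trans (+-cong (-‿inverseʳ s) (-‿inverseʳ t)) (+-identityˡ 0#)))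
                        (zeroˡ w)) ⟨
    2# * z₀ ^ 3 * (2# * (z₀ * z₃ ^ 2) + tail z₁ z₂ z₃) + ((s - s) + (t - t)) * w
      ≈⟨ solve 8 (λ b c p q r u s′ t′ →
           let two = con 2
               s = two :* c :* q :^ 3
               t = b :* p :* q :* r
               w = two :* (p :^ 2 :* u) :+ (c :* q :^ 3 :+ t)
           in two :* p :^ 3 :* (two :* (p :* u :^ 2) :+ (c :* r :^ 3 :+ b :* q :* r :* u))
              :+ ((s :+ s′) :+ (t :+ t′)) :* w
           := c :^ 2 :* q :^ 6 :+ b :* c :* p :* q :^ 4 :* r :+ two :* c :* p :^ 3 :* r :^ 3
              :+ w :^ 2 :+ (s′ :+ t′) :* w)
           refl α₂ α₃ z₀ z₁ z₂ z₃ (- s) (- t) ⟩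
    numerator₂ z₀ z₁ z₂ w ∎)
    where
    w = root z₀ z₁ z₂ z₃
    s = 2# * α₃ * z₁ ^ 3
    t = α₂ * z₀ * z₁ * z₂

  module _ (z₀ z₁ z₂ z₃ w₁ : Carrier) where

    R1⇒root : 2# * z₀ ^ 2 * z₃ ≈ numerator₁ z₀ z₁ z₂ w₁ → w₁ ≈ root z₀ z₁ z₂ z₃
    R1⇒root r1 = begin
      w₁
        ≈⟨ numerator₁+tail z₀ z₁ z₂ w₁ ⟨
      numerator₁ z₀ z₁ z₂ w₁ + tail z₀ z₁ z₂
        ≈⟨ +-congʳ r1 ⟨
      2# * z₀ ^ 2 * z₃ + tail z₀ z₁ z₂
        ≈⟨ +-congʳ (*-assoc 2# (z₀ ^ 2) z₃) ⟩
      root z₀ z₁ z₂ z₃ ∎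

    root⇒R1 : w₁ ≈ root z₀ z₁ z₂ z₃ → 2# * z₀ ^ 2 * z₃ ≈ numerator₁ z₀ z₁ z₂ w₁
    root⇒R1 w₁≈ = +-cancelʳ (tail z₀ z₁ z₂) _ _ (begin
      2# * z₀ ^ 2 * z₃ + tail z₀ z₁ z₂
        ≈⟨ +-congʳ (*-assoc 2# (z₀ ^ 2) z₃) ⟩
      root z₀ z₁ z₂ z₃
        ≈⟨ w₁≈ ⟨
      w₁
        ≈⟨ numerator₁+tail z₀ z₁ z₂ w₁ ⟨
      numerator₁ z₀ z₁ z₂ w₁ + tail z₀ z₁ z₂ ∎)

    module _ (w₁≈ : w₁ ≈ root z₀ z₁ z₂ z₃) where

      w₁² : w₁ ^ 2 ≈ discriminant z₀ z₁ z₂ + 2# * 2# * z₀ ^ 2 * quadratic z₀ z₁ z₂ z₃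
      w₁² = trans (^-congˡ 2 w₁≈) (root² z₀ z₁ z₂ z₃)

      E⇒S : quadratic z₀ z₁ z₂ z₃ ≈ 0# → w₁ ^ 2 ≈ discriminant z₀ z₁ z₂
      E⇒S e = trans w₁² (trans (+-congˡ (trans (*-congˡ e) (zeroʳ _))) (+-identityʳ _))

      -- Comparing (S) with `w₁²` cancels the discriminant and leaves 4 z₀² times `quadratic` equal
      -- to 0; `r` inverts that factor.
      S⇒E : ∀ r → r * (2# * 2# * z₀ ^ 2) ≈ 1# →
        w₁ ^ 2 ≈ discriminant z₀ z₁ z₂ → quadratic z₀ z₁ z₂ z₃ ≈ 0#
      S⇒E r unit s = *-cancelˡ-unit unit
        (trans (+-cancelˡ (discriminant z₀ z₁ z₂) _ _
                 (trans (sym w₁²) (trans s (sym (+-identityʳ _)))))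
               (sym (zeroʳ _)))

      numerator₂-w₁ : numerator₂ z₀ z₁ z₂ w₁ ≈
        2# * z₀ ^ 3 * (2# * (z₀ * z₃ ^ 2) + tail z₁ z₂ z₃)
      numerator₂-w₁ = trans
        (+-cong (+-congˡ (^-congˡ 2 w₁≈)) (*-congˡ w₁≈))
        (numerator₂-root z₀ z₁ z₂ z₃)

      module _ (z₄ w₂ : Carrier) (w₂≈ : w₂ ≈ root z₁ z₂ z₃ z₄) where

        -- Both sides contain the same `tail z₁ z₂ z₃`, so they differ only in z₁² z₄ against z₀
        -- z₃².
        Coh⇒R2 : z₁ ^ 2 * z₄ ≈ z₀ * z₃ ^ 2 → 2# * z₀ ^ 3 * w₂ ≈ numerator₂ z₀ z₁ z₂ w₁
        Coh⇒R2 coh = begin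
          2# * z₀ ^ 3 * w₂
            ≈⟨ *-congˡ w₂≈ ⟩
          2# * z₀ ^ 3 * root z₁ z₂ z₃ z₄
            ≈⟨ *-congˡ (+-congʳ (*-congˡ coh)) ⟩
          2# * z₀ ^ 3 * (2# * (z₀ * z₃ ^ 2) + tail z₁ z₂ z₃)
            ≈⟨ numerator₂-w₁ ⟨
          numerator₂ z₀ z₁ z₂ w₁ ∎

        R2⇒Coh : ∀ r h → r * (2# * z₀ ^ 3) ≈ 1# → h * 2# ≈ 1# →
          2# * z₀ ^ 3 * w₂ ≈ numerator₂ z₀ z₁ z₂ w₁ → z₁ ^ 2 * z₄ ≈ z₀ * z₃ ^ 2
        R2⇒Coh r h unit unit₂ r2 =
          -- The outer factor 2 z₀³ is divided out first, then the common tail is subtracted, then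
          -- the remaining 2 is divided out.
          *-cancelˡ-unit unit₂ (+-cancelʳ (tail z₁ z₂ z₃) _ _ (*-cancelˡ-unit unit (begin
            2# * z₀ ^ 3 * root z₁ z₂ z₃ z₄
              ≈⟨ *-congˡ w₂≈ ⟨
            2# * z₀ ^ 3 * w₂
              ≈⟨ r2 ⟩
            numerator₂ z₀ z₁ z₂ w₁
              ≈⟨ numerator₂-w₁ ⟩
            2# * z₀ ^ 3 * (2# * (z₀ * z₃ ^ 2) + tail z₁ z₂ z₃) ∎)))

-- Clearing denominators in ℂ.

open CommutativeRing ℂ-commutativeRing using (_≈_; _*_; 1#; refl; sym; trans; setoid; semiring; *-assoc; *-comm; *-congˡ; *-identityʳ)
open Exp semiring using (_^_)

recipˣ : ℂ* → ℂ
recipˣ (d , nz) = recipᶜ d nz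

recipˣ-inverseˡ : ∀ d → recipˣ d * val d ≈ 1#
recipˣ-inverseˡ (d , nz) = recipᶜ-inverseˡ d nz

*-÷-cancel : ∀ d a → val d * (a ÷ d) ≈ a
*-÷-cancel d a = begin
  val d * (a * recipˣ d) ≈⟨ *-comm (val d) (a * recipˣ d) ⟩
  a * recipˣ d * val d   ≈⟨ *-assoc a (recipˣ d) (val d) ⟩
  a * (recipˣ d * val d) ≈⟨ *-congˡ {a} (recipˣ-inverseˡ d) ⟩
  a * 1#                 ≈⟨ *-identityʳ a ⟩
  a                      ∎
  where open SetoidReasoning setoid

≈÷⇒*≈ : ∀ d a b → a ≈ b ÷ d → val d * a ≈ b
≈÷⇒*≈ d a b a≈b÷d = trans (*-congˡ {val d} a≈b÷d) (*-÷-cancel d b)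

*≈⇒≈÷ : ∀ d a b → val d * a ≈ b → a ≈ b ÷ d
*≈⇒≈÷ d a b da≈b = *-cancelˡ-unit (recipˣ-inverseˡ d) (trans da≈b (sym (*-÷-cancel d b)))
  where open Units ℂ-commutativeRing

-- Index shifts along ℤ.

-- For variable `v` the two forms of an index agree only by associativity. With numerals `k` and `i`
-- the sum `k + i` computes, so a condition at `v + k` becomes one indexed from `v`.
reindex : ∀ {ℓ} (P : ℤ → ℤ → ℤ → ℤ → Set ℓ) v k {i j l m} →
  P (v ℤ.+ k ℤ.+ i) (v ℤ.+ k ℤ.+ j) (v ℤ.+ k ℤ.+ l) (v ℤ.+ k ℤ.+ m) →
  P (v ℤ.+ (k ℤ.+ i)) (v ℤ.+ (k ℤ.+ j)) (v ℤ.+ (k ℤ.+ l)) (v ℤ.+ (k ℤ.+ m))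
reindex P v k {i} {j} {l} {m} p
  rewrite ℤ.+-assoc v k i | ℤ.+-assoc v k j | ℤ.+-assoc v k l | ℤ.+-assoc v k m = p

module Sequences (α₁ α₂ α₃ : ℂ) (x : ℤ → ℂ*) where

  open Polynomials ℂ-commutativeRing α₁ α₂ α₃ using (root)

  rootAt : ℤ → ℤ → ℤ → ℤ → ℂ
  rootAt i j k l = root (val (x i)) (val (x j)) (val (x k)) (val (x l))

  IsRoot : (ℤ → ℂ) → ℤ → Set
  IsRoot y v = y (v ℤ.+ 1ℤ) ≈ rootAt (v ℤ.+ 0ℤ) (v ℤ.+ 1ℤ) (v ℤ.+ ℤ.+ 2) (v ℤ.+ ℤ.+ 3)

  -- (Coh) at v + 1
  CohNext : ℤ → Set
  CohNext v = z₁ ^ 2 * z₄ ≈ z₀ * z₃ ^ 2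
    where
    open Conditions α₁ α₂ α₃ x v using (z; z₀; z₁; z₃)
    z₄ = z (ℤ.+ 4)

  cohNext : (∀ v → Coh α₁ α₂ α₃ x v) → ∀ v → CohNext v
  cohNext coh v = reindex
    (λ i j k l → val (x i) ^ 2 * val (x j) ≈ val (x k) * val (x l) ^ 2) v 1ℤ (coh (v ℤ.+ 1ℤ))

  cohNext⁻¹ : (∀ v → CohNext v) → ∀ v → Coh α₁ α₂ α₃ x v
  cohNext⁻¹ coh v = reindex
    (λ i j k l → val (x i) ^ 2 * val (x j) ≈ val (x k) * val (x l) ^ 2) v -1ℤ (coh (v ℤ.+ -1ℤ))

  module _ (y : ℤ → ℂ) where

    isRoot-next : ∀ v → IsRoot y (v ℤ.+ 1ℤ) →
      y (v ℤ.+ ℤ.+ 2) ≈ rootAt (v ℤ.+ 1ℤ) (v ℤ.+ ℤ.+ 2) (v ℤ.+ ℤ.+ 3) (v ℤ.+ ℤ.+ 4)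
    isRoot-next v = reindex (λ i j k l → y j ≈ rootAt i j k l) v 1ℤ

  -- `IsRoot` solved for `y` at s = v + 1, hence the offsets from -1 to 2; the summand `0ℤ` stays so
  -- that `reindex` applies.
  rootSequence : ℤ → ℂ
  rootSequence s = rootAt (s ℤ.+ -1ℤ) (s ℤ.+ 0ℤ) (s ℤ.+ 1ℤ) (s ℤ.+ ℤ.+ 2)

  rootSequence-isRoot : ∀ v → IsRoot rootSequence v
  rootSequence-isRoot v =
    reindex (λ i j k l → rootSequence (v ℤ.+ 1ℤ) ≈ rootAt i j k l) v 1ℤ refl

theorem6p4 : (α₁ α₂ α₃ : ℂ) →
    ((x : ℤ → ℂ*) →
    (∀ v → E α₁ α₂ α₃ x v) →
    (∀ v → Coh α₁ α₂ α₃ x v) →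
    ∃ λ (y : ℤ → ℂ) →
    (∀ v → R1 α₁ α₂ α₃ x v y) ×
    (∀ v → R2 α₁ α₂ α₃ x v y) ×
    (∀ v → S α₁ α₂ α₃ x v y))
    ×
    ((x : ℤ → ℂ*) (y : ℤ → ℂ) →
    (∀ v → R1 α₁ α₂ α₃ x v y) →
    (∀ v → R2 α₁ α₂ α₃ x v y) →
    (∀ v → S α₁ α₂ α₃ x v y) →
    (∀ v → E α₁ α₂ α₃ x v) × (∀ v → Coh α₁ α₂ α₃ x v))
theorem6p4 α₁ α₂ α₃ = existence , converse
  where
  open Polynomials ℂ-commutativeRing α₁ α₂ α₃

  -- The denominators are written exactly as in (R1) and (R2): comparing two
  -- syntactically different ones makes Agda unfold their reciprocals down to ℚ,
  -- which does not finish.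
  module _ (x : ℤ → ℂ*) where
    open Sequences α₁ α₂ α₃ x

    existence : (∀ v → E α₁ α₂ α₃ x v) → (∀ v → Coh α₁ α₂ α₃ x v) →
      ∃ λ y → (∀ v → R1 α₁ α₂ α₃ x v y) × (∀ v → R2 α₁ α₂ α₃ x v y) × (∀ v → S α₁ α₂ α₃ x v y)
    existence e coh = y , r1 , r2 , s
      where
      y = rootSequence
      isRoot = rootSequence-isRoot

      r1 : ∀ v → R1 α₁ α₂ α₃ x v y
      r1 v = *≈⇒≈÷ (2ˣ *ˣ z₀ˣ y ^ˣ 2) z₃ (numerator₁ z₀ z₁ z₂ (w₁ y))
        (root⇒R1 z₀ z₁ z₂ z₃ (w₁ y) (isRoot v))
        where open Conditions α₁ α₂ α₃ x v using (z₀; z₁; z₂; z₃; z₀ˣ; w₁)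

      r2 : ∀ v → R2 α₁ α₂ α₃ x v y
      r2 v = *≈⇒≈÷ (2ˣ *ˣ z₀ˣ y ^ˣ 3) (w₂ y) (numerator₂ z₀ z₁ z₂ (w₁ y))
        (Coh⇒R2 z₀ z₁ z₂ z₃ (w₁ y) (isRoot v)
          (z (ℤ.+ 4)) (w₂ y) (isRoot-next y v (isRoot (v ℤ.+ 1ℤ))) (cohNext coh v))
        where open Conditions α₁ α₂ α₃ x v using (z; z₀; z₁; z₂; z₃; z₀ˣ; w₁; w₂)

      s : ∀ v → S α₁ α₂ α₃ x v y
      s v = E⇒S z₀ z₁ z₂ z₃ (w₁ y) (isRoot v) (e v)
        where open Conditions α₁ α₂ α₃ x v using (z₀; z₁; z₂; z₃; w₁)

    converse : (y : ℤ → ℂ) →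
      (∀ v → R1 α₁ α₂ α₃ x v y) → (∀ v → R2 α₁ α₂ α₃ x v y) → (∀ v → S α₁ α₂ α₃ x v y) →
      (∀ v → E α₁ α₂ α₃ x v) × (∀ v → Coh α₁ α₂ α₃ x v)
    -- (R2) at v yields (Coh) only at v + 1; as v runs through all of ℤ, shifting back by one loses
    -- nothing.
    converse y r1 r2 s = e , cohNext⁻¹ coh
      where
      isRoot : ∀ v → IsRoot y v
      isRoot v = R1⇒root z₀ z₁ z₂ z₃ (w₁ y)
        (≈÷⇒*≈ (2ˣ *ˣ z₀ˣ y ^ˣ 2) z₃ (numerator₁ z₀ z₁ z₂ (w₁ y)) (r1 v))
        where open Conditions α₁ α₂ α₃ x v using (z₀; z₁; z₂; z₃; z₀ˣ; w₁)

      e : ∀ v → E α₁ α₂ α₃ x v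
      e v = S⇒E z₀ z₁ z₂ z₃ (w₁ y) (isRoot v)
        -- The factor 4 z₀² is written as `2# * 2# * z₀ ^ 2` so that it is the value of a product in
        -- `ℂ*`, whose reciprocal is at hand.
        (recipˣ (2ˣ *ˣ 2ˣ *ˣ z₀ˣ y ^ˣ 2)) (recipˣ-inverseˡ (2ˣ *ˣ 2ˣ *ˣ z₀ˣ y ^ˣ 2)) (s v)
        where open Conditions α₁ α₂ α₃ x v using (z₀; z₁; z₂; z₃; z₀ˣ; w₁)

      coh : ∀ v → CohNext v
      coh v = R2⇒Coh z₀ z₁ z₂ z₃ (w₁ y) (isRoot v)
        (z (ℤ.+ 4)) (w₂ y) (isRoot-next y v (isRoot (v ℤ.+ 1ℤ)))
        (recipˣ (2ˣ *ˣ z₀ˣ y ^ˣ 3)) (recipˣ 2ˣ)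
        (recipˣ-inverseˡ (2ˣ *ˣ z₀ˣ y ^ˣ 3)) (recipˣ-inverseˡ 2ˣ)
        (≈÷⇒*≈ (2ˣ *ˣ z₀ˣ y ^ˣ 3) (w₂ y) (numerator₂ z₀ z₁ z₂ (w₁ y)) (r2 v))
        where open Conditions α₁ α₂ α₃ x v using (z; z₀; z₁; z₂; z₃; z₀ˣ; w₁; w₂)
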